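{- Let $G$ be a finite group and let $S$ be a $2$-separable generating set of $G$ with $1\in S$ and $|S|\ge 3$. Assume that $|G|\ge 2\alpha_2(S)+\kappa_2(S)$ and $\kappa_2(S)=\kappa_1(S)=|S|-1$, and that no $2$-atom of $S$ or of $S^{ -1}$ is a subgroup or has cardinality $2$. If $S$ does not have $2$-fragments that are subgroups of $G$, and if $A=H\cup Ha$ is a $2$-atom of $S$ which is the union of two right cosets of a subgroup $H$ of $G$ ($a\in G$), then $HS$ is the complement in $G$ of the union of exactly two right cosets $Hx$ modulo $H$.
   Context: Let $G$ be a finite group and $S$ a generating subset of $G$ containing $1$. For $X\subseteq G$ put $\partial X=XS\setminus X$ and $X^*=G\setminus (X\cup\partial X)=G\setminus XS$. For $k\ge 1$, $S$ is $k$-separable if there is $X\subseteq G$ with $|X|\ge k$ and $|X^*|\ge k$. If $S$ is $k$-separable, $\kappa_k(S)=\min\{|\partial X| : |X|\ge k,\ |X^*|\ge k\}$; a set $X$ with $|X|\ge k$, $|X^*|\ge k$ achieving this minimum is a $k$-fragment of $S$; a $k$-fragment of minimum cardinality is a $k$-atom of $S$; $\alpha_k(S)$ is the cardinality of a $k$-atom of $S$. The same notions for $S^{ -1}=\{s^{ -1}:s\in S\}$ are obtained by replacing $S$ by $S^{ -1}$ throughout. -}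

module Defs where

open import Level using (Level; suc; _⊔_)
open import Algebra.Bundles using (Group)
open import Data.Fin.Base using (Fin)
open import Data.Fin.Properties using (any?; _≟_)
open import Data.Fin.Subset using (Subset; _∈_; _⊆_; _∪_; _─_; ∁; ⊤; ⁅_⁆; ∣_∣)
open import Data.Fin.Subset.Properties using (_∈?_)
open import Data.Nat.Base using (ℕ; _≤_)
open import Data.Product.Base using (_×_; ∃)
open import Data.Vec.Base using (tabulate)
open import Function.Base using (_∘_)
open import Function.Bundles using (Inverse)
open import Relation.Binary.PropositionalEquality using (_≡_; setoid)
open import Relation.Nullary.Decidable using (does; _×-dec_)
open import Relation.Unary using (Pred; Decidable)

private
  variable
    c ℓ p a : Level

record FiniteGroup (c ℓ : Level) : Set (suc (c ⊔ ℓ)) where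
  field
    group       : Group c ℓ
    order       : ℕ
    enumeration : Inverse (Group.setoid group) (setoid (Fin order))

  open Group group public

  index : Carrier → Fin order
  index = Inverse.to enumeration

  element : Fin order → Carrier
  element = Inverse.from enumeration

⟪_⟫ : ∀ {n} {P : Pred (Fin n) p} → Decidable P → Subset n
⟪ P? ⟫ = tabulate (does ∘ P?)

IsMinimum : {A : Set a} → Pred A p → (A → ℕ) → ℕ → Set (a ⊔ p)
IsMinimum P f m = (∃ λ x → P x × f x ≡ m) × (∀ x → P x → m ≤ f x)

-- A subset of G is represented by the set of indices of its elements, so
-- that propositional equality of subsets is extensional and ∣_∣ is the
-- number of elements of G up to _≈_.

module GroupSubsets (G : FiniteGroup c ℓ) where

  open FiniteGroup G

  SubsetOf : Set
  SubsetOf = Subset order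

  infix 4 _∈ᴳ_
  _∈ᴳ_ : Carrier → SubsetOf → Set
  x ∈ᴳ X = index x ∈ X

  infixl 7 _·_ _·ʳ_
  _·_ : SubsetOf → SubsetOf → SubsetOf
  X · Y = ⟪ (λ g → any? λ i → any? λ j →
    (i ∈? X) ×-dec (j ∈? Y) ×-dec (g ≟ index (element i ∙ element j))) ⟫

  infix 8 _⁻¹ˢ
  _⁻¹ˢ : SubsetOf → SubsetOf
  X ⁻¹ˢ = ⟪ (λ g → any? λ i → (i ∈? X) ×-dec (g ≟ index (element i ⁻¹))) ⟫

  _·ʳ_ : SubsetOf → Carrier → SubsetOf
  X ·ʳ x = X · ⁅ index x ⁆

  record IsSubgroup (H : SubsetOf) : Set (c ⊔ ℓ) where
    field
      ε-closed  : ε ∈ᴳ H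
      ∙-closed  : ∀ {x y} → x ∈ᴳ H → y ∈ᴳ H → x ∙ y ∈ᴳ H
      ⁻¹-closed : ∀ {x} → x ∈ᴳ H → x ⁻¹ ∈ᴳ H

  Generates : SubsetOf → Set (c ⊔ ℓ)
  Generates S = ∀ H → IsSubgroup H → S ⊆ H → H ≡ ⊤

  -- ∂ and co take S as a parameter: ∂ S X = XS \ X and
  -- co S X = X* = G \ (X ∪ ∂X).

  ∂ : SubsetOf → SubsetOf → SubsetOf
  ∂ S X = (X · S) ─ X

  co : SubsetOf → SubsetOf → SubsetOf
  co S X = ∁ (X ∪ ∂ S X)

  Admissible : ℕ → SubsetOf → SubsetOf → Set
  Admissible k S X = k ≤ ∣ X ∣ × k ≤ ∣ co S X ∣

  Separable : ℕ → SubsetOf → Set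
  Separable k S = ∃ λ X → Admissible k S X

  Isκ : ℕ → SubsetOf → ℕ → Set
  Isκ k S m = IsMinimum (Admissible k S) (λ X → ∣ ∂ S X ∣) m

  Fragment : ℕ → SubsetOf → SubsetOf → Set
  Fragment k S X = Admissible k S X × Isκ k S ∣ ∂ S X ∣

  Atom : ℕ → SubsetOf → SubsetOf → Set
  Atom k S X = Fragment k S X × IsMinimum (Fragment k S) ∣_∣ ∣ X ∣

  Isα : ℕ → SubsetOf → ℕ → Set
  Isα k S m = ∃ λ X → Atom k S X × ∣ X ∣ ≡ m

{-# OPTIONS --safe #-}
module Submission where

-- Write A = H ∪ Ha, k = ∣ A ∣, κ for the common value of κ₁(S) and κ₂(S), and call
-- X critical if ∣ XS ∣ = ∣ X ∣ + κ.  Since A is not a subgroup and does not have two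
-- elements, a ∉ H, ∣ H ∣ ≥ 2 and k = 2 ∣ H ∣ ≥ 4.
--
-- The main point is that G ∖ AS has at most k elements (order-bound).  Call the
-- left translates of A lines.  Through every point g pass the two lines gA and
-- ga⁻¹A, which differ because A is not a subgroup (translate-distinct).  As
-- X ↦ ∣ XS ∣ is submodular and κ₁ = κ₂, a line B that meets a critical set X, is not
-- contained in X and satisfies (X ∪ B)S ≠ G meets X in a single point, and X ∪ B is
-- again critical (cross); so each line added enlarges XS by k - 1.
--
-- Suppose that G ∖ AS had more than k elements.  Starting from X = A, attach lines
-- to X one after the other, always at a point of the line attached last (grow),
-- until the number m of elements outside XS satisfies k + 1 ≤ m ≤ 2k - 1.  At this
-- moment at least k - 1 further lines leave X at distinct points of one line.  If
-- m ≤ 2k - 2, the sets G ∖ (X ∪ B)S for these lines B are disjoint of size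
-- m - k + 1 ≥ 2 in a set of size m, which is too small for them (no-small-rest).  If
-- m = 2k - 1, the sets (X ∪ B)S ∖ XS are disjoint of size k - 1 in a set of size
-- 2k - 1, again a contradiction (no-large-rest).
--
-- Together with ∣ G ∣ ≥ 2k + κ this gives that G ∖ AS has exactly k = 2 ∣ H ∣ elements.
-- Finally HS = AS: as H is not a 2-fragment, ∣ HS ∣ > ∣ H ∣ + κ, so that fewer than
-- ∣ H ∣ elements of AS lie outside HS, while both sets are unions of right cosets of
-- H.  Hence G ∖ HS is a union of right cosets of H with 2 ∣ H ∣ elements.

import Algebra.Properties.Group as GroupProperties
open import Data.Bool.Properties using () renaming (_≟_ to _≟ᵇ_)
open import Data.Fin.Base using (Fin; zero; suc)
import Data.Fin.Properties as Fin
open import Data.Fin.Subset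
open import Data.Fin.Subset.Properties
open import Data.Nat.Base using (ℕ; zero; suc; _+_; _*_; _∸_; _≤_; _<_; z≤n; s≤s; s≤s⁻¹)
open import Data.Nat.Induction using (<-wellFounded)
open import Data.Nat.Properties hiding (_≟_)
open import Data.Nat.Solver using (module +-*-Solver)
open import Data.Product.Base using (_×_; _,_; ∃; ∃₂; proj₁; proj₂)
open import Data.Sum.Base using (inj₁; inj₂; [_,_]′)
open import Data.Vec.Base using (_∷_; []; here; there)
open import Data.Vec.Properties using (≡-dec; lookup∘tabulate; []=⇒lookup; lookup⇒[]=)
open import Defs
open import Function.Base using (_∘_; id)
open import Function.Bundles using (Inverse)
open import Induction.WellFounded using (Acc; acc)
open import Level using (Level)
open import Relation.Binary.Definitions using (tri<; tri≈; tri>)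
open import Relation.Binary.PropositionalEquality using (_≡_; _≢_; refl; sym; trans; cong; cong₂; subst; module ≡-Reasoning)
import Relation.Binary.Reasoning.Setoid as SetoidReasoning
open import Relation.Nullary.Decidable using (yes; no; does; dec-true; _×-dec_)
open import Relation.Nullary.Negation using (¬_; contradiction)
open import Relation.Unary using (Pred; Decidable)

private
  variable
    n m : ℕ

-- Cardinalities of finite subsets

∣p∪q∣+∣p∩q∣≡∣p∣+∣q∣ : (p q : Subset n) → ∣ p ∪ q ∣ + ∣ p ∩ q ∣ ≡ ∣ p ∣ + ∣ q ∣
∣p∪q∣+∣p∩q∣≡∣p∣+∣q∣ [] [] = refl
∣p∪q∣+∣p∩q∣≡∣p∣+∣q∣ (outside ∷ p) (outside ∷ q) = ∣p∪q∣+∣p∩q∣≡∣p∣+∣q∣ p q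
∣p∪q∣+∣p∩q∣≡∣p∣+∣q∣ (outside ∷ p) (inside ∷ q) =
  trans (cong suc (∣p∪q∣+∣p∩q∣≡∣p∣+∣q∣ p q)) (sym (+-suc ∣ p ∣ ∣ q ∣))
∣p∪q∣+∣p∩q∣≡∣p∣+∣q∣ (inside ∷ p) (outside ∷ q) = cong suc (∣p∪q∣+∣p∩q∣≡∣p∣+∣q∣ p q)
∣p∪q∣+∣p∩q∣≡∣p∣+∣q∣ (inside ∷ p) (inside ∷ q) = cong suc
  (trans (+-suc ∣ p ∪ q ∣ ∣ p ∩ q ∣)
    (trans (cong suc (∣p∪q∣+∣p∩q∣≡∣p∣+∣q∣ p q)) (sym (+-suc ∣ p ∣ ∣ q ∣))))

∣p∪q∣≤∣p∣+∣q∣ : (p q : Subset n) → ∣ p ∪ q ∣ ≤ ∣ p ∣ + ∣ q ∣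
∣p∪q∣≤∣p∣+∣q∣ p q = ≤-trans (m≤m+n _ _) (≤-reflexive (∣p∪q∣+∣p∩q∣≡∣p∣+∣q∣ p q))

∣p∣+∣∁p∣≡n : (p : Subset n) → ∣ p ∣ + ∣ ∁ p ∣ ≡ n
∣p∣+∣∁p∣≡n p = trans (cong (∣ p ∣ +_) (∣∁p∣≡n∸∣p∣ p)) (m+[n∸m]≡n (∣p∣≤n p))

∣p─q∣+∣q∣≡∣p∣ : {p q : Subset n} → q ⊆ p → ∣ p ─ q ∣ + ∣ q ∣ ≡ ∣ p ∣
∣p─q∣+∣q∣≡∣p∣ {p = []} {[]} q⊆p = refl
∣p─q∣+∣q∣≡∣p∣ {p = outside ∷ p} {outside ∷ q} q⊆p = ∣p─q∣+∣q∣≡∣p∣ (drop-∷-⊆ q⊆p)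
∣p─q∣+∣q∣≡∣p∣ {p = outside ∷ p} {inside ∷ q} q⊆p = contradiction (q⊆p here) λ ()
∣p─q∣+∣q∣≡∣p∣ {p = inside ∷ p} {outside ∷ q} q⊆p = cong suc (∣p─q∣+∣q∣≡∣p∣ (drop-∷-⊆ q⊆p))
∣p─q∣+∣q∣≡∣p∣ {p = inside ∷ p} {inside ∷ q} q⊆p =
  trans (+-suc ∣ p ─ q ∣ ∣ q ∣) (cong suc (∣p─q∣+∣q∣≡∣p∣ (drop-∷-⊆ q⊆p)))

x∈p─q⇒x∉q : (p q : Subset n) {x : Fin n} → x ∈ p ─ q → x ∉ q
x∈p─q⇒x∉q (_ ∷ p) (outside ∷ q) (there x∈) (there x∈q) = x∈p─q⇒x∉q p q x∈ x∈q
x∈p─q⇒x∉q (_ ∷ p) (inside ∷ q) (there x∈) (there x∈q) = x∈p─q⇒x∉q p q x∈ x∈q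

⊆∧∣∣≥⇒⊇ : {p q : Subset n} → p ⊆ q → ∣ q ∣ ≤ ∣ p ∣ → q ⊆ p
⊆∧∣∣≥⇒⊇ {p = p} p⊆q ∣q∣≤∣p∣ {x} x∈q with x ∈? p
... | yes x∈p = x∈p
... | no  x∉p = contradiction (p⊂q⇒∣p∣<∣q∣ (p⊆q , x , x∈q , x∉p)) (≤⇒≯ ∣q∣≤∣p∣)

∣p∣≥1⇒nonempty : (p : Subset n) → 1 ≤ ∣ p ∣ → Nonempty p
∣p∣≥1⇒nonempty {n} p 1≤ with nonempty? p
... | yes ne = ne
... | no  ¬ne = contradiction
  (subst (1 ≤_) (trans (cong ∣_∣ (Empty-unique ¬ne)) (∣⊥∣≡0 n)) 1≤) λ ()

x∈p⇒⁅x⁆⊆p : {p : Subset n} {x : Fin n} → x ∈ p → ⁅ x ⁆ ⊆ p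
x∈p⇒⁅x⁆⊆p {p = p} {x} x∈p y∈ = subst (_∈ p) (sym (x∈⁅y⁆⇒x≡y x y∈)) x∈p

nonempty⇒∣p∣≥1 : {p : Subset n} {x : Fin n} → x ∈ p → 1 ≤ ∣ p ∣
nonempty⇒∣p∣≥1 {x = x} x∈p = subst (_≤ _) (∣⁅x⁆∣≡1 x) (p⊆q⇒∣p∣≤∣q∣ (x∈p⇒⁅x⁆⊆p x∈p))

∣p∣≤1⇒unique : {p : Subset n} → ∣ p ∣ ≤ 1 → {x y : Fin n} → x ∈ p → y ∈ p → x ≡ y
∣p∣≤1⇒unique {p = p} ∣p∣≤1 {x} {y} x∈p y∈p =
  sym (x∈⁅y⁆⇒x≡y x (⊆∧∣∣≥⇒⊇ (x∈p⇒⁅x⁆⊆p x∈p) (subst (∣ p ∣ ≤_) (sym (∣⁅x⁆∣≡1 x)) ∣p∣≤1) y∈p))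

∣p∣≤1+∣p-x∣ : (p : Subset n) (x : Fin n) → ∣ p ∣ ≤ suc ∣ p - x ∣
∣p∣≤1+∣p-x∣ p x = ≤-trans (p⊆q⇒∣p∣≤∣q∣ split)
  (≤-trans (∣p∪q∣≤∣p∣+∣q∣ ⁅ x ⁆ (p - x)) (≤-reflexive (cong (_+ ∣ p - x ∣) (∣⁅x⁆∣≡1 x))))
  where
  split : p ⊆ ⁅ x ⁆ ∪ (p - x)
  split {y} y∈p with y Fin.≟ x
  ... | yes refl = x∈p∪q⁺ (inj₁ (x∈⁅x⁆ x))
  ... | no  y≢x  = x∈p∪q⁺ (inj₂ (x∈p∧x≢y⇒x∈p-y y∈p y≢x))

-- Disjoint subsets of Y, each with at least x elements and indexed by P, occupy
-- at least ∣ P ∣ * x elements of Y.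
disjoint-packing : (P : Subset n) (f : Fin n → Subset m) (Y : Subset m) (x : ℕ) →
  (∀ {i} → i ∈ P → f i ⊆ Y) → (∀ {i} → i ∈ P → x ≤ ∣ f i ∣) →
  (∀ {i j} → i ∈ P → j ∈ P → i ≢ j → Empty (f i ∩ f j)) →
  ∣ P ∣ * x ≤ ∣ Y ∣
disjoint-packing [] f Y x f⊆Y x≤f disj = z≤n
disjoint-packing (outside ∷ P) f Y x f⊆Y x≤f disj =
  disjoint-packing P (f ∘ suc) Y x (f⊆Y ∘ there) (x≤f ∘ there)
    (λ i∈P j∈P i≢j → disj (there i∈P) (there j∈P) (i≢j ∘ Fin.suc-injective))
disjoint-packing (inside ∷ P) f Y x f⊆Y x≤f disj = begin
  x + ∣ P ∣ * x                  ≤⟨ +-mono-≤ (x≤f here) rest ⟩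
  ∣ f zero ∣ + ∣ Y ─ f zero ∣    ≡⟨ +-comm ∣ f zero ∣ _ ⟩
  ∣ Y ─ f zero ∣ + ∣ f zero ∣    ≡⟨ ∣p─q∣+∣q∣≡∣p∣ (f⊆Y here) ⟩
  ∣ Y ∣                          ∎
  where
  open ≤-Reasoning
  rest : ∣ P ∣ * x ≤ ∣ Y ─ f zero ∣
  rest = disjoint-packing P (f ∘ suc) (Y ─ f zero) x
    (λ i∈P y∈fi → x∈p∧x∉q⇒x∈p─q (f⊆Y (there i∈P) y∈fi)
      λ y∈f0 → disj here (there i∈P) (λ ()) (_ , x∈p∩q⁺ (y∈f0 , y∈fi)))
    (x≤f ∘ there)
    (λ i∈P j∈P i≢j → disj (there i∈P) (there j∈P) (i≢j ∘ Fin.suc-injective))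

injection-size : (P : Subset n) (Q : Subset m) (φ : Fin n → Fin m) →
  (∀ {i} → i ∈ P → φ i ∈ Q) → (∀ {i j} → φ i ≡ φ j → i ≡ j) → ∣ P ∣ ≤ ∣ Q ∣
injection-size P Q φ φP⊆Q φ-inj = subst (_≤ ∣ Q ∣) (*-identityʳ ∣ P ∣)
  (disjoint-packing P (λ i → ⁅ φ i ⁆) Q 1 (x∈p⇒⁅x⁆⊆p ∘ φP⊆Q)
    (λ {i} _ → ≤-reflexive (sym (∣⁅x⁆∣≡1 (φ i))))
    λ {i} {j} _ _ i≢j (y , y∈) → i≢j (φ-inj
      (trans (sym (x∈⁅y⁆⇒x≡y (φ i) (proj₁ (x∈p∩q⁻ ⁅ φ i ⁆ ⁅ φ j ⁆ y∈))))
             (x∈⁅y⁆⇒x≡y (φ j) (proj₂ (x∈p∩q⁻ ⁅ φ i ⁆ ⁅ φ j ⁆ y∈))))))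

+-tight : ∀ {a b c d} → c ≤ a → d ≤ b → a + b ≤ c + d → a ≡ c × b ≡ d
+-tight {a} {b} {c} {d} c≤a d≤b a+b≤c+d =
    ≤-antisym (+-cancelʳ-≤ d a c (≤-trans (+-monoʳ-≤ a d≤b) a+b≤c+d)) c≤a
  , ≤-antisym (+-cancelˡ-≤ c b d (≤-trans (+-monoˡ-≤ b c≤a) a+b≤c+d)) d≤b

-- Critical sets and lines

-- The isoperimetric data of X ↦ N X = XS on the n points of G, with d + 1 the
-- size of a 2-atom.  A set is critical when it attains the bound ∣ X ∣ + κ for
-- ∣ N X ∣, and a line is a critical set of d + 1 elements: for the translates of
-- a 2-atom the last field says that every point lies on at least two of them.
-- The condition that X* has at least j elements is written j + ∣ N X ∣ ≤ n, so
-- critical-size expresses that no 2-fragment is smaller than a line.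
record Expansion (n κ d : ℕ) : Set where
  field
    N      : Subset n → Subset n
    N-mono : ∀ {X Y} → X ⊆ Y → N X ⊆ N Y
    N-∪    : ∀ X Y → N (X ∪ Y) ⊆ N X ∪ N Y

  Critical : Subset n → Set
  Critical X = ∣ N X ∣ ≡ ∣ X ∣ + κ

  Line : Subset n → Set
  Line B = ∣ B ∣ ≡ suc d × Critical B

  field
    expands  : ∀ X → 1 ≤ ∣ X ∣ → ∣ N X ∣ < n → ∣ X ∣ + κ ≤ ∣ N X ∣
    critical-size : ∀ X → 2 ≤ ∣ X ∣ → 2 + ∣ N X ∣ ≤ n → Critical X → suc d ≤ ∣ X ∣
    another-line : ∀ B (p : Fin n) → ∃ λ C → Line C × p ∈ C × C ≢ B

module LineGeometry {n κ d : ℕ} (E : Expansion n κ d) (3≤d : 3 ≤ d) where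

  open Expansion E
  open ≤-Reasoning
  open +-*-Solver using (solve; _:=_; _:+_; con)

  -- A chosen line through p other than B.
  another : Subset n → Fin n → Subset n
  another B p = proj₁ (another-line B p)

  another-isLine : ∀ B p → Line (another B p)
  another-isLine B p = proj₁ (proj₂ (another-line B p))

  ∈-another : ∀ B p → p ∈ another B p
  ∈-another B p = proj₁ (proj₂ (proj₂ (another-line B p)))

  another-≢ : ∀ B p → another B p ≢ B
  another-≢ B p = proj₂ (proj₂ (proj₂ (another-line B p)))

  -- The neighbourhood size is submodular: N (X ∪ Y) lies in the union of N X and
  -- N Y, and N (X ∩ Y) in their intersection.
  submodular : ∀ X Y → ∣ N (X ∪ Y) ∣ + ∣ N (X ∩ Y) ∣ ≤ ∣ N X ∣ + ∣ N Y ∣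
  submodular X Y = begin
    ∣ N (X ∪ Y) ∣ + ∣ N (X ∩ Y) ∣      ≤⟨ +-mono-≤ (p⊆q⇒∣p∣≤∣q∣ (N-∪ X Y)) (p⊆q⇒∣p∣≤∣q∣ N∩⊆) ⟩
    ∣ N X ∪ N Y ∣ + ∣ N X ∩ N Y ∣      ≡⟨ ∣p∪q∣+∣p∩q∣≡∣p∣+∣q∣ (N X) (N Y) ⟩
    ∣ N X ∣ + ∣ N Y ∣                  ∎
    where
    N∩⊆ : N (X ∩ Y) ⊆ N X ∩ N Y
    N∩⊆ z∈ = x∈p∩q⁺ (N-mono (p∩q⊆p X Y) z∈ , N-mono (p∩q⊆q X Y) z∈)

  critical-submodular : ∀ {X Y} → Critical X → Critical Y →
    ∣ N (X ∪ Y) ∣ + ∣ N (X ∩ Y) ∣ ≤ (∣ X ∪ Y ∣ + κ) + (∣ X ∩ Y ∣ + κ)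
  critical-submodular {X} {Y} crX crY = begin
    ∣ N (X ∪ Y) ∣ + ∣ N (X ∩ Y) ∣          ≤⟨ submodular X Y ⟩
    ∣ N X ∣ + ∣ N Y ∣                      ≡⟨ cong₂ _+_ crX crY ⟩
    (∣ X ∣ + κ) + (∣ Y ∣ + κ)              ≡⟨ swap ∣ X ∣ ∣ Y ∣ ⟩
    (∣ X ∣ + ∣ Y ∣) + (κ + κ)              ≡⟨ cong (_+ (κ + κ)) (∣p∪q∣+∣p∩q∣≡∣p∣+∣q∣ X Y) ⟨
    (∣ X ∪ Y ∣ + ∣ X ∩ Y ∣) + (κ + κ)      ≡⟨ swap ∣ X ∪ Y ∣ ∣ X ∩ Y ∣ ⟨
    (∣ X ∪ Y ∣ + κ) + (∣ X ∩ Y ∣ + κ)      ∎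
    where
    swap : ∀ a b → (a + κ) + (b + κ) ≡ (a + b) + (κ + κ)
    swap a b = solve 3 (λ a b c → (a :+ c) :+ (b :+ c) := (a :+ b) :+ (c :+ c)) refl a b κ

  -- The strict inequality says that the complement of N B has more than d + 1
  -- elements, for any line B.  It is refuted in the end.
  module _ (room : suc d + κ + suc d < n) where

    line-room : ∀ {B} → Line B → 2 + ∣ N B ∣ ≤ n
    line-room {B} (∣B∣≡ , crB) = begin
      2 + ∣ N B ∣           ≡⟨ cong (2 +_) (trans crB (cong (_+ κ) ∣B∣≡)) ⟩
      2 + (suc d + κ)       ≡⟨ +-comm 2 (suc d + κ) ⟩
      suc d + κ + 2         ≤⟨ +-monoʳ-≤ (suc d + κ) (s≤s (≤-trans (s≤s z≤n) 3≤d)) ⟩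
      suc d + κ + suc d     ≤⟨ <⇒≤ room ⟩
      n                     ∎

    2+N∩≤n : ∀ {X B} → Line B → 2 + ∣ N (X ∩ B) ∣ ≤ n
    2+N∩≤n {X} {B} lB = ≤-trans (+-monoʳ-≤ 2 (p⊆q⇒∣p∣≤∣q∣ (N-mono (p∩q⊆q X B)))) (line-room lB)

    -- By submodularity both X ∪ B and X ∩ B are critical.  Were there two points in
    -- X ∩ B, it would be no smaller than a line and hence all of B.
    cross : ∀ {X B p} → Critical X → Line B → p ∈ X → p ∈ B → ¬ (B ⊆ X) → ∣ N (X ∪ B) ∣ < n →
      ∣ X ∩ B ∣ ≡ 1 × Critical (X ∪ B) × ∣ N (X ∪ B) ∣ ≡ ∣ N X ∣ + d
    cross {X} {B} {p} crX lB@(∣B∣≡ , crB) p∈X p∈B B⊈X N∪<n = ∣∩∣≡1 , proj₁ tight , N∪≡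
      where
      ∩≥1 : 1 ≤ ∣ X ∩ B ∣
      ∩≥1 = nonempty⇒∣p∣≥1 (x∈p∩q⁺ (p∈X , p∈B))

      tight : Critical (X ∪ B) × Critical (X ∩ B)
      tight = +-tight
        (expands (X ∪ B) (≤-trans ∩≥1 (≤-trans (∣p∩q∣≤∣p∣ X B) (∣p∣≤∣p∪q∣ X B))) N∪<n)
        (expands (X ∩ B) ∩≥1 (≤-trans (m≤n+m _ 1) (2+N∩≤n {X} lB)))
        (critical-submodular crX crB)

      ∣∩∣≡1 : ∣ X ∩ B ∣ ≡ 1
      ∣∩∣≡1 with 2 ≤? ∣ X ∩ B ∣
      ... | no  ≱2 = ≤-antisym (s≤s⁻¹ (≰⇒> ≱2)) ∩≥1
      ... | yes ≥2 = contradiction (λ {x} → p∩q⊆p X B ∘ B⊆∩ {x}) B⊈X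
        where
        B⊆∩ : B ⊆ X ∩ B
        B⊆∩ = ⊆∧∣∣≥⇒⊇ (p∩q⊆q X B)
          (subst (_≤ ∣ X ∩ B ∣) (sym ∣B∣≡) (critical-size (X ∩ B) ≥2 (2+N∩≤n {X} lB) (proj₂ tight)))

      ∣∪∣≡ : ∣ X ∪ B ∣ ≡ ∣ X ∣ + d
      ∣∪∣≡ = +-cancelʳ-≡ 1 _ _ (begin-equality
        ∣ X ∪ B ∣ + 1              ≡⟨ cong (∣ X ∪ B ∣ +_) ∣∩∣≡1 ⟨
        ∣ X ∪ B ∣ + ∣ X ∩ B ∣      ≡⟨ ∣p∪q∣+∣p∩q∣≡∣p∣+∣q∣ X B ⟩
        ∣ X ∣ + ∣ B ∣              ≡⟨ cong (∣ X ∣ +_) ∣B∣≡ ⟩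
        ∣ X ∣ + suc d              ≡⟨ solve 2 (λ a b → a :+ (con 1 :+ b) := a :+ b :+ con 1) refl ∣ X ∣ d ⟩
        ∣ X ∣ + d + 1              ∎)

      N∪≡ : ∣ N (X ∪ B) ∣ ≡ ∣ N X ∣ + d
      N∪≡ = begin-equality
        ∣ N (X ∪ B) ∣       ≡⟨ proj₁ tight ⟩
        ∣ X ∪ B ∣ + κ       ≡⟨ cong (_+ κ) ∣∪∣≡ ⟩
        ∣ X ∣ + d + κ       ≡⟨ solve 3 (λ a b c → a :+ b :+ c := a :+ c :+ b) refl ∣ X ∣ d κ ⟩
        ∣ X ∣ + κ + d       ≡⟨ cong (_+ d) crX ⟨
        ∣ N X ∣ + d         ∎

    -- If at least d + 1 points lie outside N X, the last hypothesis of cross holds.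
    N∪<n : ∀ {X B p} → Critical X → Line B → p ∈ X → p ∈ B → ∣ N X ∣ + suc d ≤ n → ∣ N (X ∪ B) ∣ < n
    N∪<n {X} {B} {p} crX lB@(∣B∣≡ , crB) p∈X p∈B NX+k≤n = begin-strict
      ∣ N (X ∪ B) ∣        ≤⟨ +-cancelʳ-≤ (∣ X ∩ B ∣ + κ) _ _ (≤-trans
                                (+-monoʳ-≤ _ (expands (X ∩ B) ∩≥1 (≤-trans (m≤n+m _ 1) (2+N∩≤n {X} lB))))
                                (critical-submodular crX crB)) ⟩
      ∣ X ∪ B ∣ + κ        <⟨ +-monoˡ-< κ ∪< ⟩
      ∣ X ∣ + suc d + κ    ≡⟨ solve 3 (λ a b c → a :+ b :+ c := a :+ c :+ b) refl ∣ X ∣ (suc d) κ ⟩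
      ∣ X ∣ + κ + suc d    ≡⟨ cong (_+ suc d) crX ⟨
      ∣ N X ∣ + suc d      ≤⟨ NX+k≤n ⟩
      n                    ∎
      where
      ∩≥1 : 1 ≤ ∣ X ∩ B ∣
      ∩≥1 = nonempty⇒∣p∣≥1 (x∈p∩q⁺ (p∈X , p∈B))

      ∪< : ∣ X ∪ B ∣ < ∣ X ∣ + suc d
      ∪< = begin-strict
        ∣ X ∪ B ∣                  <⟨ m<m+n ∣ X ∪ B ∣ ∩≥1 ⟩
        ∣ X ∪ B ∣ + ∣ X ∩ B ∣      ≡⟨ ∣p∪q∣+∣p∩q∣≡∣p∣+∣q∣ X B ⟩
        ∣ X ∣ + ∣ B ∣              ≡⟨ cong (∣ X ∣ +_) ∣B∣≡ ⟩
        ∣ X ∣ + suc d              ∎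

    line⊈ : ∀ {B C} → Line B → Line C → C ≢ B → ¬ (C ⊆ B)
    line⊈ (∣B∣≡ , _) (∣C∣≡ , _) C≢B C⊆B =
      C≢B (⊆-antisym C⊆B (⊆∧∣∣≥⇒⊇ C⊆B (≤-reflexive (trans ∣B∣≡ (sym ∣C∣≡)))))

    lines-meet-once : ∀ {B C} → Line B → Line C → C ≢ B → ∣ B ∩ C ∣ ≤ 1
    lines-meet-once {B} {C} lB@(∣B∣≡ , crB) lC C≢B with nonempty? (B ∩ C)
    ... | no  empty = subst (_≤ 1) (sym (trans (cong ∣_∣ (Empty-unique empty)) (∣⊥∣≡0 n))) z≤n
    ... | yes (p , p∈∩) with p∈B , p∈C ← x∈p∩q⁻ B C p∈∩ =
      ≤-reflexive (proj₁ (cross crB lC p∈B p∈C (line⊈ lB lC C≢B) (N∪<n crB lC p∈B p∈C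
        (subst (λ z → z + suc d ≤ n) (sym (trans crB (cong (_+ κ) ∣B∣≡))) (<⇒≤ room)))))

    covered-line : ∀ {X B C} → Line B → B ⊆ X ∪ C → ∣ C ∩ B ∣ ≤ 1 → d ≤ ∣ X ∩ B ∣
    covered-line {X} {B} {C} (∣B∣≡ , _) B⊆∪ ∩≤1 = s≤s⁻¹ (begin
      suc d                              ≡⟨ ∣B∣≡ ⟨
      ∣ B ∣                              ≤⟨ p⊆q⇒∣p∣≤∣q∣ split ⟩
      ∣ (X ∩ B) ∪ (C ∩ B) ∣              ≤⟨ ∣p∪q∣≤∣p∣+∣q∣ (X ∩ B) (C ∩ B) ⟩
      ∣ X ∩ B ∣ + ∣ C ∩ B ∣              ≤⟨ +-monoʳ-≤ ∣ X ∩ B ∣ ∩≤1 ⟩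
      ∣ X ∩ B ∣ + 1                      ≡⟨ +-comm ∣ X ∩ B ∣ 1 ⟩
      suc ∣ X ∩ B ∣                      ∎)
      where
      split : B ⊆ (X ∩ B) ∪ (C ∩ B)
      split x∈B = x∈p∪q⁺ ([ (λ x∈X → inj₁ (x∈p∩q⁺ (x∈X , x∈B)))
                          , (λ x∈C → inj₂ (x∈p∩q⁺ (x∈C , x∈B))) ]′ (x∈p∪q⁻ X C (B⊆∪ x∈B)))

    -- A critical set X containing a line B that has at least d points, collected in
    -- P, through each of which another line leaves X, that is, is not contained in X.
    -- For a single line all points
    -- qualify; after a line C is attached to X at a point p, all points of C except
    -- p do.
    record Tip (X : Subset n) : Set where
      field
        critical : Critical X
        B        : Subset n
        B-line   : Line B
        B⊆X      : B ⊆ X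
        P        : Subset n
        P⊆B      : P ⊆ B
        ∣P∣≥d    : d ≤ ∣ P ∣
        leaves   : ∀ {p} → p ∈ P → ¬ (another B p ⊆ X)

    line-tip : ∀ {B} → Line B → Tip B
    line-tip {B} lB@(∣B∣≡ , crB) = record
      { critical = crB ; B = B ; B-line = lB ; B⊆X = λ x∈ → x∈ ; P = B ; P⊆B = λ x∈ → x∈
      ; ∣P∣≥d = ≤-trans (n≤1+n d) (≤-reflexive (sym ∣B∣≡))
      ; leaves = λ {p} _ → line⊈ lB (another-isLine B p) (another-≢ B p) }

    -- Attaching to X a line that leaves it.
    grow : ∀ {X} → Tip X → ∣ N X ∣ + (suc d + suc d) ≤ n →
      ∃ λ Y → Tip Y × ∣ N Y ∣ ≡ ∣ N X ∣ + d
    grow {X} T NX+2k≤n = X ∪ C , tip , proj₂ (proj₂ crossC)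
      where
      open Tip T
      p∃ : Nonempty P
      p∃ = ∣p∣≥1⇒nonempty P (≤-trans (s≤s z≤n) (≤-trans 3≤d ∣P∣≥d))
      p : Fin n
      p = proj₁ p∃
      p∈P : p ∈ P
      p∈P = proj₂ p∃
      p∈X : p ∈ X
      p∈X = B⊆X (P⊆B p∈P)
      C : Subset n
      C = another B p
      C-line : Line C
      C-line = another-isLine B p
      p∈C : p ∈ C
      p∈C = ∈-another B p
      NX+k≤n : ∣ N X ∣ + suc d ≤ n
      NX+k≤n = ≤-trans (+-monoʳ-≤ ∣ N X ∣ (m≤m+n (suc d) (suc d))) NX+2k≤n
      crossC : ∣ X ∩ C ∣ ≡ 1 × Critical (X ∪ C) × ∣ N (X ∪ C) ∣ ≡ ∣ N X ∣ + d
      crossC = cross critical C-line p∈X p∈C (leaves p∈P) (N∪<n critical C-line p∈X p∈C NX+k≤n)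

      -- A line D through a point q ≠ p of C meets C only in q.  Inside X ∪ C it would
      -- have its other d points in X, so all its points, and q would be a second
      -- common point of X and C.
      stays-out : ∀ {q} → q ∈ C - p → ¬ (another C q ⊆ X ∪ C)
      stays-out {q} q∈ D⊆∪ = x∈p─q⇒x∉q C ⁅ p ⁆ q∈ (subst (_∈ ⁅ p ⁆) p≡q (x∈⁅x⁆ p))
        where
        q∈C : q ∈ C
        q∈C = p─q⊆p C ⁅ p ⁆ q∈
        D : Subset n
        D = another C q
        D-line : Line D
        D-line = another-isLine C q
        d≤∣X∩D∣ : d ≤ ∣ X ∩ D ∣
        d≤∣X∩D∣ = covered-line D-line D⊆∪ (lines-meet-once C-line D-line (another-≢ C q))
        D⊆X : D ⊆ X
        D⊆X with D ⊆? X
        ... | yes D⊆X = D⊆X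
        ... | no  D⊈X with r , r∈ ← ∣p∣≥1⇒nonempty (X ∩ D) (≤-trans (s≤s z≤n) (≤-trans 3≤d d≤∣X∩D∣))
                      with r∈X , r∈D ← x∈p∩q⁻ X D r∈ =
          contradiction (subst (3 ≤_) (proj₁ (cross critical D-line r∈X r∈D D⊈X
              (N∪<n critical D-line r∈X r∈D NX+k≤n))) (≤-trans 3≤d d≤∣X∩D∣))
            λ { (s≤s ()) }
        p≡q : p ≡ q
        p≡q = ∣p∣≤1⇒unique (≤-reflexive (proj₁ crossC))
          (x∈p∩q⁺ (p∈X , p∈C)) (x∈p∩q⁺ (D⊆X (∈-another C q) , q∈C))

      tip : Tip (X ∪ C)
      tip = record
        { critical = proj₁ (proj₂ crossC) ; B = C ; B-line = C-line ; B⊆X = q⊆p∪q X C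
        ; P = C - p ; P⊆B = p─q⊆p C ⁅ p ⁆
        ; ∣P∣≥d = s≤s⁻¹ (subst (_≤ suc ∣ C - p ∣) (proj₁ C-line) (∣p∣≤1+∣p-x∣ C p))
        ; leaves = stays-out }

    -- The extensions of X by the lines leaving it at the points of P.
    module _ {X : Subset n} (T : Tip X) (NX+k≤n : ∣ N X ∣ + suc d ≤ n) where
      open Tip T

      extend : Fin n → Subset n
      extend p = X ∪ another B p

      extend-critical : ∀ {p} → p ∈ P → Critical (extend p) × ∣ N (extend p) ∣ ≡ ∣ N X ∣ + d
      extend-critical {p} p∈P = proj₂ (cross critical (another-isLine B p) p∈X (∈-another B p) (leaves p∈P)
          (N∪<n critical (another-isLine B p) p∈X (∈-another B p) NX+k≤n))
        where
        p∈X : p ∈ X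
        p∈X = B⊆X (P⊆B p∈P)

      -- Two extensions combine to a critical set, unless nothing remains outside.
      extend₂ : ∀ {p q} → p ∈ P → q ∈ P → p ≢ q → ∣ N (extend p ∪ another B q) ∣ < n →
        ∣ N (extend p ∪ another B q) ∣ ≡ ∣ N X ∣ + d + d
      extend₂ {p} {q} p∈P q∈P p≢q N<n = trans
          (proj₂ (proj₂ (cross (proj₁ (extend-critical p∈P)) D-line
            (p⊆p∪q C (B⊆X (P⊆B q∈P))) (∈-another B q) D⊈ N<n)))
          (cong (_+ d) (proj₂ (extend-critical p∈P)))
        where
        C D : Subset n
        C = another B p
        D = another B q
        D-line : Line D
        D-line = another-isLine B q
        D≢C : D ≢ C
        D≢C D≡C = p≢q (∣p∣≤1⇒unique
          (lines-meet-once B-line (another-isLine B p) (another-≢ B p))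
          (x∈p∩q⁺ (P⊆B p∈P , ∈-another B p))
          (x∈p∩q⁺ (P⊆B q∈P , subst (q ∈_) D≡C (∈-another B q))))
        D⊈ : ¬ (D ⊆ extend p)
        D⊈ D⊆ = contradiction
          (≤-trans 3≤d (subst (d ≤_)
            (proj₁ (cross critical D-line (B⊆X (P⊆B q∈P)) (∈-another B q) (leaves q∈P)
              (N∪<n critical D-line (B⊆X (P⊆B q∈P)) (∈-another B q) NX+k≤n)))
            (covered-line D-line D⊆ (lines-meet-once (another-isLine B p) D-line D≢C))))
          λ { (s≤s ()) }

      N-extend₂ : ∀ p q → N (extend p ∪ another B q) ⊆ N (extend p) ∪ N (extend q)
      N-extend₂ p q z∈ = x∈p∪q⁺ ([ inj₁ , inj₂ ∘ N-mono (q⊆p∪q X (another B q)) ]′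
        (x∈p∪q⁻ (N (extend p)) (N (another B q)) (N-∪ (extend p) (another B q) z∈)))

      -- The complement of N X has d + x elements, and that of N (extend p) has x.
      -- These smaller complements are disjoint for different p: if two extensions left
      -- a common element uncovered, they would together cover d + d ≥ d + x elements
      -- outside N X.  There are at least d of them, but d * x exceeds d + x.
      no-small-rest : ∀ x → 2 ≤ x → x ≤ d → n ≢ ∣ N X ∣ + d + x
      no-small-rest x 2≤x x≤d n≡ = contradiction (begin
        d * x               ≤⟨ *-monoˡ-≤ x ∣P∣≥d ⟩
        ∣ P ∣ * x           ≤⟨ disjoint-packing P (∁ ∘ N ∘ extend) (∁ (N X)) x
                                 (λ {p} _ → p⊆q⇒∁p⊇∁q (N-mono (p⊆p∪q (another B p))))
                                 (λ p∈P → ≤-reflexive (sym (rest-size p∈P))) rests-disjoint ⟩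
        ∣ ∁ (N X) ∣         ≡⟨ +-cancelˡ-≡ ∣ N X ∣ _ _ (trans (∣p∣+∣∁p∣≡n (N X)) (trans n≡ (+-assoc ∣ N X ∣ d x))) ⟩
        d + x               ∎) (<⇒≱ (sum<product 3≤d 2≤x))
        where
        open +-*-Solver using (_:*_)
        sum<product : ∀ {a b} → 3 ≤ a → 2 ≤ b → a + b < a * b
        sum<product {suc (suc (suc a))} {suc (suc b)} (s≤s (s≤s (s≤s _))) (s≤s (s≤s _)) = begin-strict
          (3 + a) + (2 + b)                 <⟨ m<m+n _ (s≤s z≤n) ⟩
          (3 + a) + (2 + b) + suc (a + b * (2 + a)) ≡⟨ solve 2 (λ a b →
            (con 3 :+ a) :+ (con 2 :+ b) :+ (con 1 :+ (a :+ b :* (con 2 :+ a))) := (con 3 :+ a) :* (con 2 :+ b)) refl a b ⟩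
          (3 + a) * (2 + b)                 ∎
        rest-size : ∀ {p} → p ∈ P → ∣ ∁ (N (extend p)) ∣ ≡ x
        rest-size {p} p∈P = +-cancelˡ-≡ (∣ N X ∣ + d) _ _ (begin-equality
          ∣ N X ∣ + d + ∣ ∁ (N (extend p)) ∣        ≡⟨ cong (_+ ∣ ∁ (N (extend p)) ∣) (proj₂ (extend-critical p∈P)) ⟨
          ∣ N (extend p) ∣ + ∣ ∁ (N (extend p)) ∣   ≡⟨ ∣p∣+∣∁p∣≡n (N (extend p)) ⟩
          n                                         ≡⟨ n≡ ⟩
          ∣ N X ∣ + d + x                           ∎)
        rests-disjoint : ∀ {p q} → p ∈ P → q ∈ P → p ≢ q → Empty (∁ (N (extend p)) ∩ ∁ (N (extend q)))
        rests-disjoint {p} {q} p∈P q∈P p≢q (z , z∈∩) = <-irrefl refl (begin-strict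
          ∣ N X ∣ + d + d                     ≡⟨ extend₂ p∈P q∈P p≢q N<n ⟨
          ∣ N (extend p ∪ another B q) ∣      <⟨ N<n ⟩
          n                                   ≡⟨ n≡ ⟩
          ∣ N X ∣ + d + x                     ≤⟨ +-monoʳ-≤ (∣ N X ∣ + d) x≤d ⟩
          ∣ N X ∣ + d + d                     ∎)
          where
          z∉ : z ∉ N (extend p ∪ another B q)
          z∉ z∈ with x∈p∩q⁻ (∁ (N (extend p))) (∁ (N (extend q))) z∈∩
          ... | z∉p , z∉q = [ x∈∁p⇒x∉p z∉p , x∈∁p⇒x∉p z∉q ]′
            (x∈p∪q⁻ (N (extend p)) (N (extend q)) (N-extend₂ p q z∈))
          N<n : ∣ N (extend p ∪ another B q) ∣ < n
          N<n = subst (∣ N (extend p ∪ another B q) ∣ <_) (∣⊤∣≡n n)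
            (p⊂q⇒∣p∣<∣q∣ (⊆⊤ , z , ∈⊤ , z∉))

      -- The complement of N X has 2d + 1 elements.  Two extensions together leave at
      -- most one element uncovered, so N (extend p) and N (extend q) have only N X in
      -- common: the d elements each gains over N X are disjoint.  There are at least
      -- d such gains, but d * d exceeds 2d + 1.
      no-large-rest : n ≢ ∣ N X ∣ + d + suc d
      no-large-rest n≡ = contradiction (begin
        d * d               ≤⟨ *-monoˡ-≤ d ∣P∣≥d ⟩
        ∣ P ∣ * d           ≤⟨ disjoint-packing P (λ p → N (extend p) ─ N X) (∁ (N X)) d
                                 (λ {p} _ z∈ → x∉p⇒x∈∁p (x∈p─q⇒x∉q (N (extend p)) (N X) z∈))
                                 (λ p∈P → ≤-reflexive (sym (gain-size p∈P))) gains-disjoint ⟩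
        ∣ ∁ (N X) ∣         ≡⟨ +-cancelˡ-≡ ∣ N X ∣ _ _ (trans (∣p∣+∣∁p∣≡n (N X)) (trans n≡ (+-assoc ∣ N X ∣ d (suc d)))) ⟩
        d + suc d           ∎) (<⇒≱ 2d+1<d²)
        where
        2d+1<d² : d + suc d < d * d
        2d+1<d² = begin-strict
          d + suc d         ≡⟨ +-suc d d ⟩
          suc (d + d)       <⟨ m<n+m (suc (d + d)) {2} (s≤s z≤n) ⟩
          3 + (d + d)       ≡⟨ cong (λ e → 3 + (d + e)) (+-identityʳ d) ⟨
          3 + 2 * d         ≤⟨ +-monoˡ-≤ (2 * d) 3≤d ⟩
          3 * d             ≤⟨ *-monoˡ-≤ d 3≤d ⟩
          d * d             ∎
        NX⊆ : ∀ p → N X ⊆ N (extend p)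
        NX⊆ p = N-mono (p⊆p∪q (another B p))
        gain-size : ∀ {p} → p ∈ P → ∣ N (extend p) ─ N X ∣ ≡ d
        gain-size {p} p∈P = +-cancelʳ-≡ ∣ N X ∣ _ _ (trans (∣p─q∣+∣q∣≡∣p∣ (NX⊆ p))
          (trans (proj₂ (extend-critical p∈P)) (+-comm ∣ N X ∣ d)))
        gains-disjoint : ∀ {p q} → p ∈ P → q ∈ P → p ≢ q →
          Empty ((N (extend p) ─ N X) ∩ (N (extend q) ─ N X))
        gains-disjoint {p} {q} p∈P q∈P p≢q (z , z∈∩)
          with z∈p , z∈q ← x∈p∩q⁻ (N (extend p) ─ N X) (N (extend q) ─ N X) z∈∩ =
          x∈p─q⇒x∉q (N (extend p)) (N X) z∈p (both⊆ (x∈p∩q⁺ (p─q⊆p _ (N X) z∈p , p─q⊆p _ (N X) z∈q)))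
          where
          U = N (extend p ∪ another B q)
          union-large : ∣ N X ∣ + d + d ≤ ∣ U ∣
          union-large with suc ∣ U ∣ ≤? n
          ... | yes U<n = ≤-reflexive (sym (extend₂ p∈P q∈P p≢q U<n))
          ... | no  U≮n = ≤-trans (+-monoʳ-≤ (∣ N X ∣ + d) (n≤1+n d))
                            (≤-trans (≤-reflexive (sym n≡)) (s≤s⁻¹ (≰⇒> U≮n)))
          both⊆ : N (extend p) ∩ N (extend q) ⊆ N X
          both⊆ = ⊆∧∣∣≥⇒⊇ (λ z∈ → x∈p∩q⁺ (NX⊆ p z∈ , NX⊆ q z∈))
            (+-cancelˡ-≤ (∣ N X ∣ + d + d) _ _ (begin
              ∣ N X ∣ + d + d + ∣ N (extend p) ∩ N (extend q) ∣
                ≤⟨ +-monoˡ-≤ _ (≤-trans union-large (p⊆q⇒∣p∣≤∣q∣ (N-extend₂ p q))) ⟩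
              ∣ N (extend p) ∪ N (extend q) ∣ + ∣ N (extend p) ∩ N (extend q) ∣
                ≡⟨ ∣p∪q∣+∣p∩q∣≡∣p∣+∣q∣ (N (extend p)) (N (extend q)) ⟩
              ∣ N (extend p) ∣ + ∣ N (extend q) ∣
                ≡⟨ cong₂ _+_ (proj₂ (extend-critical p∈P)) (proj₂ (extend-critical q∈P)) ⟩
              ∣ N X ∣ + d + (∣ N X ∣ + d)
                ≡⟨ solve 2 (λ a b → a :+ b :+ (a :+ b) := a :+ b :+ b :+ a) refl ∣ N X ∣ d ⟩
              ∣ N X ∣ + d + d + ∣ N X ∣ ∎))

    -- Descent on x, where d + x is the size of the complement of N X.  Each growth
    -- step lowers x by d, so x reaches the range 2 ≤ x ≤ d + 1, which the two
    -- preceding lemmas exclude.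
    no-tip : ∀ {x X} → Acc _<_ x → Tip X → 2 ≤ x → n ≢ ∣ N X ∣ + d + x
    no-tip {x} {X} _ T 2≤x n≡ with <-cmp x (suc d)
    no-tip {x} {X} _ T 2≤x n≡ | tri< x<1+d _ _ = no-small-rest T (begin
        ∣ N X ∣ + suc d     ≡⟨ solve 2 (λ a b → a :+ (con 1 :+ b) := a :+ b :+ con 1) refl ∣ N X ∣ d ⟩
        ∣ N X ∣ + d + 1     ≤⟨ +-monoʳ-≤ (∣ N X ∣ + d) (<⇒≤ 2≤x) ⟩
        ∣ N X ∣ + d + x     ≡⟨ n≡ ⟨
        n                   ∎) x 2≤x (s≤s⁻¹ x<1+d) n≡
    no-tip {x} {X} _ T 2≤x n≡ | tri≈ _ refl _ = no-large-rest T (begin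
        ∣ N X ∣ + suc d     ≤⟨ +-monoˡ-≤ (suc d) (m≤m+n ∣ N X ∣ d) ⟩
        ∣ N X ∣ + d + suc d ≡⟨ n≡ ⟨
        n                   ∎) n≡
    no-tip {x} {X} (acc smaller) T 2≤x n≡ | tri> _ _ 1+d<x
      with y , refl ← m≤n⇒∃[o]m+o≡n 1+d<x
      with Y , T′ , NY≡ ← grow T (begin
            ∣ N X ∣ + (suc d + suc d)     ≤⟨ m≤m+n _ y ⟩
            ∣ N X ∣ + (suc d + suc d) + y ≡⟨ solve 3 (λ a b c →
              a :+ (con 1 :+ b :+ (con 1 :+ b)) :+ c := a :+ b :+ (con 2 :+ b :+ c)) refl ∣ N X ∣ d y ⟩
            ∣ N X ∣ + d + (2 + d + y)     ≡⟨ n≡ ⟨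
            n                             ∎) =
      no-tip (smaller 2+y<x) T′ (s≤s (s≤s z≤n)) (begin-equality
        n                             ≡⟨ n≡ ⟩
        ∣ N X ∣ + d + (2 + d + y)     ≡⟨ solve 3 (λ a b c →
          a :+ b :+ (con 2 :+ b :+ c) := a :+ b :+ b :+ (con 2 :+ c)) refl ∣ N X ∣ d y ⟩
        ∣ N X ∣ + d + d + (2 + y)     ≡⟨ cong (λ z → z + d + (2 + y)) NY≡ ⟨
        ∣ N Y ∣ + d + (2 + y)         ∎)
      where
      2+y<x : 2 + y < 2 + d + y
      2+y<x = s≤s (s≤s (+-monoˡ-≤ y (≤-trans (s≤s z≤n) 3≤d)))

  -- The complement of N B has at most d + 1 elements, for a line B.
  order-bound : ∀ {B} → Line B → n ≤ suc d + κ + suc d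
  order-bound {B} lB@(∣B∣≡ , crB) with n ≤? suc d + κ + suc d
  ... | yes n≤ = n≤
  ... | no  n≰ with y , n≡ ← m≤n⇒∃[o]m+o≡n (≰⇒> n≰) =
    contradiction (begin-equality
        n                           ≡⟨ n≡ ⟨
        suc (suc d + κ + suc d) + y ≡⟨ solve 3 (λ a b c →
          con 1 :+ (con 1 :+ a :+ b :+ (con 1 :+ a)) :+ c := con 1 :+ a :+ b :+ a :+ (con 2 :+ c)) refl d κ y ⟩
        suc d + κ + d + (2 + y)     ≡⟨ cong (λ z → z + d + (2 + y)) (trans crB (cong (_+ κ) ∣B∣≡)) ⟨
        ∣ N B ∣ + d + (2 + y)       ∎)
      (no-tip (≰⇒> n≰) (<-wellFounded (2 + y)) (line-tip (≰⇒> n≰) lB) (s≤s (s≤s z≤n)))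

-- Products, translates and cosets

∈⟪⟫⁺ : ∀ {n p} {P : Pred (Fin n) p} (P? : Decidable P) {i : Fin n} → P i → i ∈ ⟪ P? ⟫
∈⟪⟫⁺ P? {i} Pi = lookup⇒[]= i ⟪ P? ⟫ (trans (lookup∘tabulate _ i) (dec-true (P? i) Pi))

∈⟪⟫⁻ : ∀ {n p} {P : Pred (Fin n) p} (P? : Decidable P) {i : Fin n} → i ∈ ⟪ P? ⟫ → P i
∈⟪⟫⁻ P? {i} i∈ with P? i | trans (sym (lookup∘tabulate (does ∘ P?) i)) ([]=⇒lookup i∈)
... | yes Pi | _ = Pi
... | no  _  | ()

IsMinimum-unique : ∀ {a p} {A : Set a} {P : Pred A p} {f : A → ℕ} {m m′ : ℕ} →
  IsMinimum P f m → IsMinimum P f m′ → m ≡ m′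
IsMinimum-unique ((x , Px , fx≡m) , min) ((y , Py , fy≡m′) , min′) =
  ≤-antisym (subst (_ ≤_) fy≡m′ (min y Py)) (subst (_ ≤_) fx≡m (min′ x Px))

module Products {c ℓ : Level} (G : FiniteGroup c ℓ) where

  open FiniteGroup G renaming (refl to ≈-refl; sym to ≈-sym; trans to ≈-trans)
  open GroupSubsets G
  open GroupProperties group using (⁻¹-anti-homo-∙; ∙-cancelˡ; ∙-cancelʳ)

  index-element : ∀ i → index (element i) ≡ i
  index-element = Inverse.strictlyInverseˡ enumeration

  element-index : ∀ x → element (index x) ≈ x
  element-index = Inverse.strictlyInverseʳ enumeration

  index-cong : ∀ {x y} → x ≈ y → index x ≡ index y
  index-cong = Inverse.to-cong enumeration

  index-injective : ∀ {x y} → index x ≡ index y → x ≈ y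
  index-injective {x} {y} eq = ≈-trans (≈-sym (element-index x))
    (≈-trans (Inverse.from-cong enumeration eq) (element-index y))

  element-injective : ∀ {i j} → element i ≈ element j → i ≡ j
  element-injective {i} {j} eq = trans (sym (index-element i)) (trans (index-cong eq) (index-element j))

  ∈-resp-≈ : ∀ {x y} X → x ≈ y → x ∈ᴳ X → y ∈ᴳ X
  ∈-resp-≈ X x≈y = subst (_∈ X) (index-cong x≈y)

  element-∈ : ∀ {i X} → i ∈ X → element i ∈ᴳ X
  element-∈ {i} {X} = subst (_∈ X) (sym (index-element i))

  ⊆-elementwise : ∀ {X Y} → (∀ {x} → x ∈ᴳ X → x ∈ᴳ Y) → X ⊆ Y
  ⊆-elementwise {X} {Y} X⊆Y {i} i∈X = subst (_∈ Y) (index-element i) (X⊆Y (element-∈ i∈X))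

  -- The decision procedure by which X · Y is tabulated.
  _factors?_ : ∀ X Y → Decidable λ g → ∃ λ i → ∃ λ j →
    i ∈ X × j ∈ Y × g ≡ index (element i ∙ element j)
  (X factors? Y) g = Fin.any? λ i → Fin.any? λ j →
    (i ∈? X) ×-dec (j ∈? Y) ×-dec (g Fin.≟ index (element i ∙ element j))

  ·-⁺ : ∀ {x y z} X Y → x ∈ᴳ X → y ∈ᴳ Y → z ≈ x ∙ y → z ∈ᴳ X · Y
  ·-⁺ {x} {y} X Y x∈X y∈Y z≈xy = ∈⟪⟫⁺ (X factors? Y)
    (index x , index y , x∈X , y∈Y ,
      index-cong (≈-trans z≈xy (∙-cong (≈-sym (element-index x)) (≈-sym (element-index y)))))

  ·-⁻ : ∀ {z} X Y → z ∈ᴳ X · Y → ∃₂ λ x y → x ∈ᴳ X × y ∈ᴳ Y × z ≈ x ∙ y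
  ·-⁻ X Y z∈ with i , j , i∈X , j∈Y , eq ← ∈⟪⟫⁻ (X factors? Y) z∈ =
    element i , element j , element-∈ i∈X , element-∈ j∈Y , index-injective eq

  ·-assoc : ∀ X Y Z → (X · Y) · Z ≡ X · (Y · Z)
  ·-assoc X Y Z = ⊆-antisym (⊆-elementwise to) (⊆-elementwise from)
    where
    to : ∀ {w} → w ∈ᴳ (X · Y) · Z → w ∈ᴳ X · (Y · Z)
    to w∈ with u , z , u∈ , z∈ , w≈uz ← ·-⁻ (X · Y) Z w∈
          with x , y , x∈ , y∈ , u≈xy ← ·-⁻ X Y u∈ =
      ·-⁺ X (Y · Z) x∈ (·-⁺ Y Z y∈ z∈ ≈-refl) (≈-trans w≈uz (≈-trans (∙-congʳ u≈xy) (assoc x y z)))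
    from : ∀ {w} → w ∈ᴳ X · (Y · Z) → w ∈ᴳ (X · Y) · Z
    from w∈ with x , v , x∈ , v∈ , w≈xv ← ·-⁻ X (Y · Z) w∈
            with y , z , y∈ , z∈ , v≈yz ← ·-⁻ Y Z v∈ =
      ·-⁺ (X · Y) Z (·-⁺ X Y x∈ y∈ ≈-refl) z∈
        (≈-trans w≈xv (≈-trans (∙-congˡ v≈yz) (≈-sym (assoc x y z))))

  ·-monoˡ : ∀ {X Y} Z → X ⊆ Y → X · Z ⊆ Y · Z
  ·-monoˡ {X} {Y} Z X⊆Y = ⊆-elementwise λ w∈ →
    let x , z , x∈ , z∈ , w≈xz = ·-⁻ X Z w∈ in ·-⁺ Y Z (X⊆Y x∈) z∈ w≈xz

  ·-distribʳ-∪ : ∀ Z X Y → (X ∪ Y) · Z ⊆ X · Z ∪ Y · Z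
  ·-distribʳ-∪ Z X Y = ⊆-elementwise λ w∈ →
    let x , z , x∈ , z∈ , w≈xz = ·-⁻ (X ∪ Y) Z w∈ in
    x∈p∪q⁺ ([ (λ x∈X → inj₁ (·-⁺ X Z x∈X z∈ w≈xz)) , (λ x∈Y → inj₂ (·-⁺ Y Z x∈Y z∈ w≈xz)) ]′ (x∈p∪q⁻ X Y x∈))

  -- The left translate gX.
  infixl 7 _·ˡ_
  _·ˡ_ : Carrier → SubsetOf → SubsetOf
  g ·ˡ X = ⁅ index g ⁆ · X

  ·ˡ-⁺ : ∀ {g x z} X → x ∈ᴳ X → z ≈ g ∙ x → z ∈ᴳ g ·ˡ X
  ·ˡ-⁺ {g} X = ·-⁺ ⁅ index g ⁆ X (x∈⁅x⁆ (index g))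

  ·ˡ-⁻ : ∀ {g z} X → z ∈ᴳ g ·ˡ X → ∃ λ x → x ∈ᴳ X × z ≈ g ∙ x
  ·ˡ-⁻ {g} X z∈ with g′ , x , g′∈ , x∈ , z≈ ← ·-⁻ ⁅ index g ⁆ X z∈ =
    x , x∈ , ≈-trans z≈ (∙-congʳ (index-injective (x∈⁅y⁆⇒x≡y (index g) g′∈)))

  ·ʳ-⁺ : ∀ {x y z} X → x ∈ᴳ X → z ≈ x ∙ y → z ∈ᴳ X ·ʳ y
  ·ʳ-⁺ {y = y} X x∈ = ·-⁺ X ⁅ index y ⁆ x∈ (x∈⁅x⁆ (index y))

  ·ʳ-⁻ : ∀ {y z} X → z ∈ᴳ X ·ʳ y → ∃ λ x → x ∈ᴳ X × z ≈ x ∙ y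
  ·ʳ-⁻ {y} X z∈ with x , y′ , x∈ , y′∈ , z≈ ← ·-⁻ X ⁅ index y ⁆ z∈ =
    x , x∈ , ≈-trans z≈ (∙-congˡ (index-injective (x∈⁅y⁆⇒x≡y (index y) y′∈)))

  ∣·ˡ∣ : ∀ g X → ∣ g ·ˡ X ∣ ≡ ∣ X ∣
  ∣·ˡ∣ g X = ≤-antisym
    (injection-size (g ·ˡ X) X (λ i → index (g ⁻¹ ∙ element i)) back
      (λ eq → element-injective (∙-cancelˡ (g ⁻¹) _ _ (index-injective eq))))
    (injection-size X (g ·ˡ X) (λ i → index (g ∙ element i))
      (λ i∈X → ·ˡ-⁺ X (element-∈ i∈X) ≈-refl)
      (λ eq → element-injective (∙-cancelˡ g _ _ (index-injective eq))))
    where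
    back : ∀ {i} → i ∈ g ·ˡ X → g ⁻¹ ∙ element i ∈ᴳ X
    back {i} i∈ with x , x∈ , eq ← ·ˡ-⁻ X (element-∈ i∈) = ∈-resp-≈ X (begin
      x                        ≈⟨ identityˡ x ⟨
      ε ∙ x                    ≈⟨ ∙-congʳ (inverseˡ g) ⟨
      g ⁻¹ ∙ g ∙ x             ≈⟨ assoc (g ⁻¹) g x ⟩
      g ⁻¹ ∙ (g ∙ x)           ≈⟨ ∙-congˡ eq ⟨
      g ⁻¹ ∙ element i         ∎) x∈
      where open SetoidReasoning setoid

  ∣·ʳ∣ : ∀ X g → ∣ X ·ʳ g ∣ ≡ ∣ X ∣
  ∣·ʳ∣ X g = ≤-antisym
    (injection-size (X ·ʳ g) X (λ i → index (element i ∙ g ⁻¹)) back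
      (λ eq → element-injective (∙-cancelʳ (g ⁻¹) _ _ (index-injective eq))))
    (injection-size X (X ·ʳ g) (λ i → index (element i ∙ g))
      (λ i∈X → ·ʳ-⁺ X (element-∈ i∈X) ≈-refl)
      (λ eq → element-injective (∙-cancelʳ g _ _ (index-injective eq))))
    where
    back : ∀ {i} → i ∈ X ·ʳ g → element i ∙ g ⁻¹ ∈ᴳ X
    back {i} i∈ with x , x∈ , eq ← ·ʳ-⁻ X (element-∈ i∈) = ∈-resp-≈ X (begin
      x                        ≈⟨ identityʳ x ⟨
      x ∙ ε                    ≈⟨ ∙-congˡ (inverseʳ g) ⟨
      x ∙ (g ∙ g ⁻¹)           ≈⟨ assoc x g (g ⁻¹) ⟨
      x ∙ g ∙ g ⁻¹             ≈⟨ ∙-congʳ eq ⟨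
      element i ∙ g ⁻¹         ∎) x∈
      where open SetoidReasoning setoid

  module Cosets {H : SubsetOf} (H-subgroup : IsSubgroup H) where

    open IsSubgroup H-subgroup

    -- HX ⊆ X, that is, X is a union of right cosets of H.
    Invariant : SubsetOf → Set c
    Invariant X = ∀ {h x} → h ∈ᴳ H → x ∈ᴳ X → h ∙ x ∈ᴳ X

    ·-invariant : ∀ {X} Y → Invariant X → Invariant (X · Y)
    ·-invariant {X} Y inv h∈ z∈ with x , y , x∈ , y∈ , z≈xy ← ·-⁻ X Y z∈ =
      ·-⁺ X Y (inv h∈ x∈) y∈ (≈-trans (∙-congˡ z≈xy) (≈-sym (assoc _ x y)))

    coset-invariant : ∀ y → Invariant (H ·ʳ y)
    coset-invariant y = ·-invariant ⁅ index y ⁆ ∙-closed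

    ∪-invariant : ∀ {X Y} → Invariant X → Invariant Y → Invariant (X ∪ Y)
    ∪-invariant {X} {Y} invX invY h∈ z∈ =
      x∈p∪q⁺ ([ inj₁ ∘ invX h∈ , inj₂ ∘ invY h∈ ]′ (x∈p∪q⁻ X Y z∈))

    coset-⊆ : ∀ {X y} → Invariant X → y ∈ᴳ X → H ·ʳ y ⊆ X
    coset-⊆ {X} inv y∈X = ⊆-elementwise λ z∈ →
      let h , h∈ , z≈hy = ·ʳ-⁻ H z∈ in ∈-resp-≈ X (≈-sym z≈hy) (inv h∈ y∈X)

    ∈-coset : ∀ y → y ∈ᴳ H ·ʳ y
    ∈-coset y = ·ʳ-⁺ H ε-closed (≈-sym (identityˡ y))

    invariant-cancel : ∀ {X h y} → Invariant X → h ∈ᴳ H → h ∙ y ∈ᴳ X → y ∈ᴳ X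
    invariant-cancel {X} {h} {y} inv h∈ hy∈ = ∈-resp-≈ X (begin
      h ⁻¹ ∙ (h ∙ y)   ≈⟨ assoc (h ⁻¹) h y ⟨
      h ⁻¹ ∙ h ∙ y     ≈⟨ ∙-congʳ (inverseˡ h) ⟩
      ε ∙ y            ≈⟨ identityˡ y ⟩
      y                ∎) (inv (⁻¹-closed h∈) hy∈)
      where open SetoidReasoning setoid

    ∁-invariant : ∀ {X} → Invariant X → Invariant (∁ X)
    ∁-invariant inv h∈ x∈ = x∉p⇒x∈∁p (x∈∁p⇒x∉p x∈ ∘ invariant-cancel inv h∈)

    ∣∪coset∣ : ∀ {X y} → Invariant X → ¬ (y ∈ᴳ X) → ∣ X ∪ H ·ʳ y ∣ ≡ ∣ X ∣ + ∣ H ∣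
    ∣∪coset∣ {X} {y} inv y∉X = begin
      ∣ X ∪ H ·ʳ y ∣                        ≡⟨ +-identityʳ _ ⟨
      ∣ X ∪ H ·ʳ y ∣ + 0                    ≡⟨ cong (∣ X ∪ H ·ʳ y ∣ +_)
                                                 (trans (cong ∣_∣ (Empty-unique disjoint)) (∣⊥∣≡0 order)) ⟨
      ∣ X ∪ H ·ʳ y ∣ + ∣ X ∩ (H ·ʳ y) ∣       ≡⟨ ∣p∪q∣+∣p∩q∣≡∣p∣+∣q∣ X (H ·ʳ y) ⟩
      ∣ X ∣ + ∣ H ·ʳ y ∣                    ≡⟨ cong (∣ X ∣ +_) (∣·ʳ∣ H y) ⟩
      ∣ X ∣ + ∣ H ∣                         ∎
      where
      open ≡-Reasoning
      disjoint : Empty (X ∩ (H ·ʳ y))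
      disjoint (i , i∈) with i∈X , i∈Hy ← x∈p∩q⁻ X (H ·ʳ y) i∈
                        with h , h∈ , eq ← ·ʳ-⁻ H (element-∈ i∈Hy) =
        y∉X (invariant-cancel inv h∈ (∈-resp-≈ X eq (element-∈ i∈X)))

    -- A union A = H ∪ Ha with aA = A is its own left stabiliser.
    union-subgroup : ∀ {a} → let A = H ∪ H ·ʳ a in
      (∀ {x} → x ∈ᴳ A → a ∙ x ∈ᴳ A) → (∀ {x} → x ∈ᴳ A → a ⁻¹ ∙ x ∈ᴳ A) → IsSubgroup A
    union-subgroup {a} aA⊆A a⁻¹A⊆A = record
      { ε-closed  = H⊆A ε-closed
      ; ∙-closed  = mul
      ; ⁻¹-closed = inv }
      where
      A : SubsetOf
      A = H ∪ H ·ʳ a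
      H⊆A : ∀ {x} → x ∈ᴳ H → x ∈ᴳ A
      H⊆A = p⊆p∪q (H ·ʳ a)
      A-invariant : Invariant A
      A-invariant = ∪-invariant ∙-closed (coset-invariant a)
      mul : ∀ {x y} → x ∈ᴳ A → y ∈ᴳ A → x ∙ y ∈ᴳ A
      mul {x} {y} x∈ y∈ with x∈p∪q⁻ H (H ·ʳ a) x∈
      ... | inj₁ x∈H = A-invariant x∈H y∈
      ... | inj₂ x∈Ha with h , h∈ , x≈ha ← ·ʳ-⁻ H x∈Ha =
        ∈-resp-≈ A (≈-sym (≈-trans (∙-congʳ x≈ha) (assoc h a y))) (A-invariant h∈ (aA⊆A y∈))
      inv : ∀ {x} → x ∈ᴳ A → x ⁻¹ ∈ᴳ A
      inv {x} x∈ with x∈p∪q⁻ H (H ·ʳ a) x∈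
      ... | inj₁ x∈H = H⊆A (⁻¹-closed x∈H)
      ... | inj₂ x∈Ha with h , h∈ , x≈ha ← ·ʳ-⁻ H x∈Ha =
        ∈-resp-≈ A (≈-sym (≈-trans (⁻¹-cong x≈ha) (⁻¹-anti-homo-∙ h a))) (a⁻¹A⊆A (H⊆A (⁻¹-closed h∈)))

    -- The translates gA and ga⁻¹A both contain g.
    translate-distinct : ∀ {a} → ¬ IsSubgroup (H ∪ H ·ʳ a) →
      ∀ g → (g ∙ a ⁻¹) ·ˡ (H ∪ H ·ʳ a) ≢ g ·ˡ (H ∪ H ·ʳ a)
    translate-distinct {a} ¬sub g eq = ¬sub (union-subgroup aA⊆A a⁻¹A⊆A)
      where
      open SetoidReasoning setoid
      A : SubsetOf
      A = H ∪ H ·ʳ a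
      a⁻¹A⊆A : ∀ {x} → x ∈ᴳ A → a ⁻¹ ∙ x ∈ᴳ A
      a⁻¹A⊆A {x} x∈ with y , y∈ , ga⁻¹x≈gy ← ·ˡ-⁻ A
          (subst (g ∙ a ⁻¹ ∙ x ∈ᴳ_) eq (·ˡ-⁺ A x∈ ≈-refl)) =
        ∈-resp-≈ A (∙-cancelˡ g _ _ (≈-sym (≈-trans (≈-sym (assoc g (a ⁻¹) x)) ga⁻¹x≈gy))) y∈
      aA⊆A : ∀ {x} → x ∈ᴳ A → a ∙ x ∈ᴳ A
      aA⊆A {x} x∈ with y , y∈ , gx≈ga⁻¹y ← ·ˡ-⁻ A
          (subst (g ∙ x ∈ᴳ_) (sym eq) (·ˡ-⁺ A x∈ ≈-refl)) = ∈-resp-≈ A (begin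
        y                     ≈⟨ identityˡ y ⟨
        ε ∙ y                 ≈⟨ ∙-congʳ (inverseʳ a) ⟨
        a ∙ a ⁻¹ ∙ y          ≈⟨ assoc a (a ⁻¹) y ⟩
        a ∙ (a ⁻¹ ∙ y)        ≈⟨ ∙-congˡ (∙-cancelˡ g _ _ (≈-trans gx≈ga⁻¹y (assoc g (a ⁻¹) y))) ⟨
        a ∙ x                 ∎) y∈

  -- Fragments and atoms of S

  module Boundary {S : SubsetOf} (ε∈S : ε ∈ᴳ S) where

    X⊆XS : ∀ X → X ⊆ X · S
    X⊆XS X = ⊆-elementwise λ x∈ → ·-⁺ X S x∈ ε∈S (≈-sym (identityʳ _))

    ∣XS∣≡∣X∣+∣∂X∣ : ∀ X → ∣ X · S ∣ ≡ ∣ X ∣ + ∣ ∂ S X ∣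
    ∣XS∣≡∣X∣+∣∂X∣ X = trans (sym (∣p─q∣+∣q∣≡∣p∣ (X⊆XS X))) (+-comm ∣ ∂ S X ∣ ∣ X ∣)

    X∪∂X≡XS : ∀ X → X ∪ ∂ S X ≡ X · S
    X∪∂X≡XS X = ⊆-antisym
      (λ i∈ → [ X⊆XS X , p─q⊆p (X · S) X ]′ (x∈p∪q⁻ X (∂ S X) i∈)) split
      where
      split : X · S ⊆ X ∪ ∂ S X
      split {i} i∈XS with i ∈? X
      ... | yes i∈X = x∈p∪q⁺ (inj₁ i∈X)
      ... | no  i∉X = x∈p∪q⁺ (inj₂ (x∈p∧x∉q⇒x∈p─q i∈XS i∉X))

    ∣XS∣+∣X*∣≡order : ∀ X → ∣ X · S ∣ + ∣ co S X ∣ ≡ order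
    ∣XS∣+∣X*∣≡order X = trans (cong (λ Y → ∣ X · S ∣ + ∣ ∁ Y ∣) (X∪∂X≡XS X)) (∣p∣+∣∁p∣≡n (X · S))

    co-room : ∀ {k} X → k + ∣ X · S ∣ ≤ order → k ≤ ∣ co S X ∣
    co-room {k} X room = +-cancelʳ-≤ ∣ X · S ∣ _ _
      (≤-trans room (≤-reflexive (trans (sym (∣XS∣+∣X*∣≡order X)) (+-comm ∣ X · S ∣ _))))

    critical-fragment : ∀ {k κ X} → Isκ k S κ → k ≤ ∣ X ∣ → k + ∣ X · S ∣ ≤ order →
      ∣ X · S ∣ ≡ ∣ X ∣ + κ → Fragment k S X
    critical-fragment {k} {κ} {X} κ-min k≤∣X∣ room crit =
      (k≤∣X∣ , co-room X room) ,
      subst (Isκ k S) (+-cancelˡ-≡ ∣ X ∣ _ _ (trans (sym crit) (∣XS∣≡∣X∣+∣∂X∣ X))) κ-min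

    fragment-critical : ∀ {k κ X} → Isκ k S κ → Fragment k S X → ∣ X · S ∣ ≡ ∣ X ∣ + κ
    fragment-critical {X = X} κ-min (_ , ∂-min) =
      trans (∣XS∣≡∣X∣+∣∂X∣ X) (cong (∣ X ∣ +_) (IsMinimum-unique ∂-min κ-min))

    κ-expands : ∀ {k κ} → Isκ k S κ → ∀ X → k ≤ ∣ X ∣ → k + ∣ X · S ∣ ≤ order → ∣ X ∣ + κ ≤ ∣ X · S ∣
    κ-expands (_ , min) X k≤∣X∣ room = ≤-trans
      (+-monoʳ-≤ ∣ X ∣ (min X (k≤∣X∣ , co-room X room))) (≤-reflexive (sym (∣XS∣≡∣X∣+∣∂X∣ X)))

    -- The expansion by S of a group with a 2-atom A = H ∪ Ha of d + 1 elements.  The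
    -- lines through p are taken from the two translates pA and pa⁻¹A.
    expansion : ∀ {κ d} → Isκ 1 S κ → Isκ 2 S κ → ∀ {H} → IsSubgroup H → ∀ a →
      let A = H ∪ H ·ʳ a in Atom 2 S A → ¬ IsSubgroup A → ∣ A ∣ ≡ suc d → Expansion order κ d
    expansion {κ} {d} κ₁-min κ₂-min {H} H-sub a (A-fragment , A-min) ¬sub ∣A∣≡ = record
      { N = _· S ; N-mono = ·-monoˡ S ; N-∪ = ·-distribʳ-∪ S
      ; expands = κ-expands κ₁-min
      ; critical-size = λ X 2≤ room crit →
          subst (_≤ ∣ X ∣) ∣A∣≡ (proj₂ A-min X (critical-fragment κ₂-min 2≤ room crit))
      ; another-line = another-translate }
      where
      open Cosets H-sub
      A : SubsetOf
      A = H ∪ H ·ʳ a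
      IsLine : SubsetOf → Set
      IsLine B = ∣ B ∣ ≡ suc d × ∣ B · S ∣ ≡ ∣ B ∣ + κ
      translate-line : ∀ g → IsLine (g ·ˡ A)
      translate-line g = trans (∣·ˡ∣ g A) ∣A∣≡ , (begin
        ∣ (g ·ˡ A) · S ∣   ≡⟨ cong ∣_∣ (·-assoc ⁅ index g ⁆ A S) ⟩
        ∣ g ·ˡ (A · S) ∣   ≡⟨ ∣·ˡ∣ g (A · S) ⟩
        ∣ A · S ∣          ≡⟨ fragment-critical κ₂-min A-fragment ⟩
        ∣ A ∣ + κ          ≡⟨ cong (_+ κ) (∣·ˡ∣ g A) ⟨
        ∣ g ·ˡ A ∣ + κ     ∎)
        where open ≡-Reasoning
      another-translate : ∀ B p → ∃ λ C → IsLine C × p ∈ C × C ≢ B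
      another-translate B p with ≡-dec _≟ᵇ_ (element p ·ˡ A) B
      ... | no  gA≢B = element p ·ˡ A , translate-line (element p) ,
        subst (_∈ element p ·ˡ A) (index-element p)
          (·ˡ-⁺ A (p⊆p∪q (H ·ʳ a) (IsSubgroup.ε-closed H-sub)) (≈-sym (identityʳ (element p)))) , gA≢B
      ... | yes gA≡B = (element p ∙ a ⁻¹) ·ˡ A , translate-line (element p ∙ a ⁻¹) ,
        subst (_∈ (element p ∙ a ⁻¹) ·ˡ A) (index-element p)
          (·ˡ-⁺ A (q⊆p∪q H (H ·ʳ a) (∈-coset a)) p≈pa⁻¹a) ,
        λ eq → translate-distinct ¬sub (element p) (trans eq (sym gA≡B))
        where
        open SetoidReasoning setoid
        p≈pa⁻¹a : element p ≈ element p ∙ a ⁻¹ ∙ a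
        p≈pa⁻¹a = begin
          element p                   ≈⟨ identityʳ (element p) ⟨
          element p ∙ ε               ≈⟨ ∙-congˡ (inverseˡ a) ⟨
          element p ∙ (a ⁻¹ ∙ a)      ≈⟨ assoc (element p) (a ⁻¹) a ⟨
          element p ∙ a ⁻¹ ∙ a        ∎

-- Two cosets in the complement

theorem14 : ∀ {c ℓ : Level} (G : FiniteGroup c ℓ) →
    let open FiniteGroup G
        open GroupSubsets G
    in
    (S : SubsetOf) →
    ε ∈ᴳ S →
    Generates S →
    Separable 2 S →
    3 ≤ ∣ S ∣ →
    (κ₁ κ₂ α₂ : ℕ) → Isκ 1 S κ₁ → Isκ 2 S κ₂ → Isα 2 S α₂ →
    2 * α₂ + κ₂ ≤ order →
    κ₂ ≡ κ₁ →
    κ₁ ≡ ∣ S ∣ ∸ 1 →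
    (∀ X → Atom 2 S X → ¬ IsSubgroup X × ∣ X ∣ ≢ 2) →
    (∀ X → Atom 2 (S ⁻¹ˢ) X → ¬ IsSubgroup X × ∣ X ∣ ≢ 2) →
    (∀ X → Fragment 2 S X → ¬ IsSubgroup X) →
    (H : SubsetOf) → IsSubgroup H →
    (a : Carrier) → Atom 2 S (H ∪ H ·ʳ a) →
    ∃₂ λ (x y : Carrier) → H ·ʳ x ≢ H ·ʳ y × H · S ≡ ∁ (H ·ʳ x ∪ H ·ʳ y)
theorem14 G S ε∈S _ _ _ κ .κ α κ₁-min κ₂-min (A₀ , A₀-atom , ∣A₀∣≡α) 2α+κ≤order refl _
  no-subgroup-atom _ no-subgroup-fragment H H-sub a A-atom@(A-fragment , A-min) =
  element i , element j , Hx≢Hy , HS≡∁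
  where
  open FiniteGroup G renaming (refl to ≈-refl; sym to ≈-sym; trans to ≈-trans)
  open GroupSubsets G
  open Products G
  open Cosets H-sub
  open Boundary {S} ε∈S
  open IsSubgroup H-sub
  open ≤-Reasoning
  open +-*-Solver using (solve; _:=_; _:+_; _:*_; con)

  A : SubsetOf
  A = H ∪ H ·ʳ a

  ¬A-subgroup : ¬ IsSubgroup A
  ¬A-subgroup = proj₁ (no-subgroup-atom A A-atom)

  a∉H : ¬ (a ∈ᴳ H)
  a∉H a∈H = ¬A-subgroup (subst IsSubgroup H≡A H-sub)
    where
    H≡A : H ≡ A
    H≡A = ⊆-antisym (p⊆p∪q (H ·ʳ a)) λ i∈ →
      [ id , coset-⊆ ∙-closed a∈H ]′ (x∈p∪q⁻ H (H ·ʳ a) i∈)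

  ∣A∣≡2∣H∣ : ∣ A ∣ ≡ ∣ H ∣ + ∣ H ∣
  ∣A∣≡2∣H∣ = ∣∪coset∣ ∙-closed a∉H

  2≤∣H∣ : 2 ≤ ∣ H ∣
  2≤∣H∣ with 2 ≤? ∣ H ∣
  ... | yes 2≤ = 2≤
  ... | no  ≱2 = contradiction
    (trans ∣A∣≡2∣H∣ (cong (λ h → h + h) (≤-antisym (s≤s⁻¹ (≰⇒> ≱2)) (nonempty⇒∣p∣≥1 ε-closed))))
    (proj₂ (no-subgroup-atom A A-atom))

  ∣AS∣≡∣A∣+κ : ∣ A · S ∣ ≡ ∣ A ∣ + κ
  ∣AS∣≡∣A∣+κ = fragment-critical κ₂-min A-fragment

  ∣A∣≡α : ∣ A ∣ ≡ α
  ∣A∣≡α = trans (IsMinimum-unique A-min (proj₂ A₀-atom)) ∣A₀∣≡α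

  -- One inequality is the bound for lines, which needs ∣ A ∣ ≥ 4; the other is the
  -- hypothesis on the order of G.
  order≡ : order ≡ ∣ A ∣ + κ + ∣ A ∣
  order≡ with e , 4+e≡∣A∣ ← m≤n⇒∃[o]m+o≡n (≤-trans (+-mono-≤ 2≤∣H∣ 2≤∣H∣) (≤-reflexive (sym ∣A∣≡2∣H∣))) =
    ≤-antisym
      (subst (λ k → order ≤ k + κ + k) 4+e≡∣A∣
        (LineGeometry.order-bound {d = 3 + e}
          (expansion κ₁-min κ₂-min H-sub a A-atom ¬A-subgroup (sym 4+e≡∣A∣))
          (s≤s (s≤s (s≤s z≤n))) {A} (sym 4+e≡∣A∣ , ∣AS∣≡∣A∣+κ)))
      (begin
        ∣ A ∣ + κ + ∣ A ∣    ≡⟨ solve 2 (λ k κ → k :+ κ :+ k := con 2 :* k :+ κ) refl ∣ A ∣ κ ⟩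
        2 * ∣ A ∣ + κ        ≡⟨ cong (λ k → 2 * k + κ) ∣A∣≡α ⟩
        2 * α + κ            ≤⟨ 2α+κ≤order ⟩
        order                ∎)

  ∣∁AS∣≡∣A∣ : ∣ ∁ (A · S) ∣ ≡ ∣ A ∣
  ∣∁AS∣≡∣A∣ = +-cancelˡ-≡ ∣ A · S ∣ _ _
    (trans (∣p∣+∣∁p∣≡n (A · S)) (trans order≡ (cong (_+ ∣ A ∣) (sym ∣AS∣≡∣A∣+κ))))

  HS⊆AS : H · S ⊆ A · S
  HS⊆AS = ·-monoˡ S (p⊆p∪q (H ·ʳ a))

  2+∣HS∣≤order : 2 + ∣ H · S ∣ ≤ order
  2+∣HS∣≤order = begin
    2 + ∣ H · S ∣             ≤⟨ +-mono-≤ 2≤∣H∣ (p⊆q⇒∣p∣≤∣q∣ HS⊆AS) ⟩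
    ∣ H ∣ + ∣ A · S ∣         ≤⟨ +-mono-≤ (∣p∣≤∣p∪q∣ H (H ·ʳ a)) (≤-reflexive ∣AS∣≡∣A∣+κ) ⟩
    ∣ A ∣ + (∣ A ∣ + κ)       ≡⟨ +-comm ∣ A ∣ _ ⟩
    ∣ A ∣ + κ + ∣ A ∣         ≡⟨ order≡ ⟨
    order                     ∎

  -- Equality would make H a 2-fragment.
  ∣H∣+κ<∣HS∣ : ∣ H ∣ + κ < ∣ H · S ∣
  ∣H∣+κ<∣HS∣ with m≤n⇒m<n∨m≡n (κ-expands κ₂-min H 2≤∣H∣ 2+∣HS∣≤order)
  ... | inj₁ lt = lt
  ... | inj₂ eq = contradiction H-sub (no-subgroup-fragment H
    (critical-fragment κ₂-min 2≤∣H∣ 2+∣HS∣≤order (sym eq)))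

  -- The difference of AS and HS is a union of right cosets of H, with fewer than
  -- ∣ H ∣ elements.
  AS⊆HS : A · S ⊆ H · S
  AS⊆HS {z} z∈AS with z ∈? (H · S)
  ... | yes z∈HS = z∈HS
  ... | no  z∉HS = contradiction (begin
      ∣ H · S ∪ H ·ʳ element z ∣     ≤⟨ p⊆q⇒∣p∣≤∣q∣ both⊆AS ⟩
      ∣ A · S ∣                      ≡⟨ trans ∣AS∣≡∣A∣+κ (cong (_+ κ) ∣A∣≡2∣H∣) ⟩
      ∣ H ∣ + ∣ H ∣ + κ              ≡⟨ solve 2 (λ h k → h :+ h :+ k := h :+ k :+ h) refl ∣ H ∣ κ ⟩
      ∣ H ∣ + κ + ∣ H ∣              ∎)
    (<⇒≱ (begin-strict
      ∣ H ∣ + κ + ∣ H ∣              <⟨ +-monoˡ-< ∣ H ∣ ∣H∣+κ<∣HS∣ ⟩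
      ∣ H · S ∣ + ∣ H ∣              ≡⟨ ∣∪coset∣ (·-invariant S ∙-closed)
                                          (λ z∈ → z∉HS (subst (_∈ H · S) (index-element z) z∈)) ⟨
      ∣ H · S ∪ H ·ʳ element z ∣     ∎))
    where
    AS-invariant : Invariant (A · S)
    AS-invariant = ·-invariant S (∪-invariant ∙-closed (coset-invariant a))
    both⊆AS : H · S ∪ H ·ʳ element z ⊆ A · S
    both⊆AS i∈ = [ HS⊆AS , coset-⊆ AS-invariant (element-∈ z∈AS) ]′ (x∈p∪q⁻ (H · S) (H ·ʳ element z) i∈)

  AS≡HS : A · S ≡ H · S
  AS≡HS = ⊆-antisym AS⊆HS HS⊆AS

  -- The complement of HS, to be split into two right cosets of H.
  F : SubsetOf
  F = ∁ (H · S)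

  ∣F∣≡2∣H∣ : ∣ F ∣ ≡ ∣ H ∣ + ∣ H ∣
  ∣F∣≡2∣H∣ = trans (cong (∣_∣ ∘ ∁) (sym AS≡HS)) (trans ∣∁AS∣≡∣A∣ ∣A∣≡2∣H∣)

  F-invariant : Invariant F
  F-invariant = ∁-invariant (·-invariant S ∙-closed)

  1≤∣H∣ : 1 ≤ ∣ H ∣
  1≤∣H∣ = <⇒≤ 2≤∣H∣

  F-nonempty : Nonempty F
  F-nonempty = ∣p∣≥1⇒nonempty F (≤-trans 1≤∣H∣ (≤-trans (m≤m+n ∣ H ∣ ∣ H ∣) (≤-reflexive (sym ∣F∣≡2∣H∣))))

  i : Fin order
  i = proj₁ F-nonempty

  Hx : SubsetOf
  Hx = H ·ʳ element i

  Hx⊆F : Hx ⊆ F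
  Hx⊆F = coset-⊆ F-invariant (element-∈ (proj₂ F-nonempty))

  F─Hx-nonempty : Nonempty (F ─ Hx)
  F─Hx-nonempty = ∣p∣≥1⇒nonempty (F ─ Hx) (≤-trans 1≤∣H∣ (≤-reflexive (sym
    (+-cancelʳ-≡ ∣ Hx ∣ _ _ (trans (∣p─q∣+∣q∣≡∣p∣ Hx⊆F)
      (trans ∣F∣≡2∣H∣ (cong (∣ H ∣ +_) (sym (∣·ʳ∣ H (element i))))))))))

  j : Fin order
  j = proj₁ F─Hx-nonempty

  y∉Hx : ¬ (element j ∈ᴳ Hx)
  y∉Hx y∈ = x∈p─q⇒x∉q F Hx (proj₂ F─Hx-nonempty) (subst (_∈ Hx) (index-element j) y∈)

  Hy : SubsetOf
  Hy = H ·ʳ element j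

  Hx≢Hy : Hx ≢ Hy
  Hx≢Hy eq = y∉Hx (subst (element j ∈ᴳ_) (sym eq) (∈-coset (element j)))

  Hx∪Hy⊆F : Hx ∪ Hy ⊆ F
  Hx∪Hy⊆F k∈ =
    [ Hx⊆F , coset-⊆ F-invariant (element-∈ (p─q⊆p F Hx (proj₂ F─Hx-nonempty))) ]′
    (x∈p∪q⁻ Hx Hy k∈)

  F⊆Hx∪Hy : F ⊆ Hx ∪ Hy
  F⊆Hx∪Hy = ⊆∧∣∣≥⇒⊇ Hx∪Hy⊆F (≤-reflexive (trans ∣F∣≡2∣H∣
    (sym (trans (∣∪coset∣ (coset-invariant _) y∉Hx) (cong (_+ ∣ H ∣) (∣·ʳ∣ H (element i)))))))

  HS≡∁ : H · S ≡ ∁ (Hx ∪ Hy)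
  HS≡∁ = ⊆-antisym
    (λ k∈HS → x∉p⇒x∈∁p λ k∈ → x∈∁p⇒x∉p (Hx∪Hy⊆F k∈) k∈HS)
    (λ k∈∁ → x∉∁p⇒x∈p λ k∈F → x∈∁p⇒x∉p k∈∁ (F⊆Hx∪Hy k∈F))
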